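{- $\mathrm{OSGMC}\not\le\mathrm{MPL}$ and $\mathrm{OSGMC}\not\le\mathrm{WMSO}$.
   Context: Trees. A tree $T$ is a subset of $\mathbb{N}^*$ (finite words over the naturals) with an element $\tau_0\in T$ (the root) such that every $\tau\in T$ has the form $\tau_0\cdot\tau'$ with $\tau'\in\mathbb{N}^*$, and whenever $\tau_0\cdot\tau\in T$ and $\tau'$ is a prefix of $\tau$, also $\tau_0\cdot\tau'\in T$. Elements of $T$ are nodes. A child of $\tau$ in $T$ is a node of $T$ of the form $\tau\cdot n$, $n\in\mathbb{N}$; a descendant of $\tau$ in $T$ is a node of $T$ of the form $\tau\cdot\tau'$, $\tau'\in\mathbb{N}^*$ (so $\tau$ is a descendant of itself). A subtree of $T$ is a subset of $T$ that is a tree (with any root). A path of $T$ is a subtree of $T$ each of whose nodes has at most one child in it. $T$ is non-blocking if every node has a child in $T$. For a finite set $AP$ of atomic propositions, a Kripke tree over $AP$ is a pair $(T,\mathrm{Lab})$ with $T$ a non-blocking tree and $\mathrm{Lab}:T\to 2^{AP}$. MPL and WMSO. Formulas over $AP$: $\varphi ::= P_a(x)\mid x\le y\mid x\in X\mid \neg\varphi\mid\varphi\wedge\varphi\mid\exists x.\varphi\mid\exists^{\alpha}X.\varphi$, with $a\in AP$. First-order variables range over nodes of $T$; $P_a(x)$ holds iff $a\in\mathrm{Lab}(x)$; $x\le y$ holds iff $y$ is a descendant of $x$; $x\in X$ is membership. Second-order variables range over all (finite or infinite) paths of $T$ in MPL, and over finite subsets of $T$ in WMSO. The logics consist of their sentences.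 OSGMC (one-step fragment of the graded $\mu$-calculus). Let $\mathrm{Var}$ be a set of fixpoint variables. For $Z,O\subseteq\mathrm{Var}$, base formulas $\varphi_{Z,O}$ and fixpoint formulas $\vartheta_{Z,O}$ are given by $\varphi_{Z,O} ::= \bot\mid\top\mid a\mid\neg\varphi_{Z,O}\mid\varphi_{Z,O}\wedge\varphi_{Z,O}\mid\varphi_{Z,O}\vee\varphi_{Z,O}\mid\Diamond^{\ge k}\varphi_{O,\emptyset}\mid\Box^{<k}\varphi_{O,\emptyset}\mid X\mid\vartheta_{\emptyset,\emptyset}$ (with $a\in AP$, $k\in\mathbb{N}$, $X\in Z$), and $\vartheta_{Z,O} ::= \mu X.\vartheta_{Z\cup\{X\},O\cup\{X\}}\mid\nu X.\vartheta_{Z\cup\{X\},O\cup\{X\}}\mid\varphi_{Z,O}$ (with $X\in\mathrm{Var}$), where every occurrence of a variable must be positive (under an even number of negations). The sentences of OSGMC are the formulas of the form $\vartheta_{\emptyset,\emptyset}$. Given a Kripke tree $\mathcal{T}=(T,\mathrm{Lab})$ and an assignment $\chi$ of subsets of $T$ to variables, the denotation $[\![\vartheta]\!]^{\mathcal T}_{\chi}\subseteq T$ is standard: $[\![a]\!]=\{w: a\in\mathrm{Lab}(w)\}$, $[\![X]\!]_\chi=\chi(X)$, Boolean connectives as set operations, $[\![\Diamond^{\ge k}\varphi]\!]_\chi=\{w\in T: |\mathrm{post}(w)\cap[\![\varphi]\!]_\chi|\ge k\}$, $[\![\Box^{<k}\varphi]\!]_\chi=\{w\in T:|\mathrm{post}(w)\setminus[\![\varphi]\!]_\chi|<k\}$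 with $\mathrm{post}(w)$ the set of children of $w$, $[\![\mu X.\vartheta]\!]_\chi=\bigcap\{W\subseteq T:[\![\vartheta]\!]_{\chi[X\mapsto W]}\subseteq W\}$, $[\![\nu X.\vartheta]\!]_\chi=\bigcup\{W\subseteq T: W\subseteq[\![\vartheta]\!]_{\chi[X\mapsto W]}\}$. A Kripke tree satisfies a sentence if its root belongs to the denotation of the sentence. Expressiveness. Two sentences over $AP$ are equivalent if they are satisfied by the same Kripke trees over $AP$. $L\le L'$ means that, for every finite $AP$, each $L$-sentence over $AP$ has an equivalent $L'$-sentence over $AP$; $L\not\le L'$ is its negation. -}

module Defs where

open import Data.Empty.Polymorphic using (⊥)
open import Data.Fin.Base using (Fin)
open import Data.Fin.Subset using (Subset) renaming (_∈_ to _∈ˢ_)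
open import Data.List.Base using (List; []; _∷_; _++_; _∷ʳ_)
open import Data.List.Membership.Propositional using () renaming (_∈_ to _∈ˡ_)
open import Data.List.Relation.Binary.Prefix.Heterogeneous using (Prefix)
open import Data.Nat.Base using (ℕ; zero; suc)
open import Data.Nat.Properties using (_≟_)
open import Data.Product.Base using (Σ; ∃; _×_)
open import Data.Sign.Base using (Sign; +; opposite)
open import Data.Vec.Base using (Vec; []; _∷_; lookup)
open import Function.Bundles using (_⇔_)
open import Function.Definitions using (Injective)
open import Level using (Level; 0ℓ; Lift) renaming (suc to lsuc)
open import Relation.Binary.PropositionalEquality.Core using (_≡_)
open import Relation.Nullary.Decidable.Core using (yes; no)
open import Relation.Nullary.Negation.Core using (¬_)
open import Relation.Unary using (Pred; _∈_; _∩_; _∪_; ∁; _⊆_; ∅)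

1ℓ : Level
1ℓ = lsuc 0ℓ

Word : Set
Word = List ℕ

infix 4 _≼_

_≼_ : Word → Word → Set
_≼_ = Prefix _≡_

record IsTree (T : Pred Word 0ℓ) (τ₀ : Word) : Set where
  field
    root∈T       : τ₀ ∈ T
    belowRoot    : ∀ τ → τ ∈ T → ∃ λ τ′ → τ ≡ τ₀ ++ τ′
    prefixClosed : ∀ τ τ′ → (τ₀ ++ τ) ∈ T → τ′ ≼ τ → (τ₀ ++ τ′) ∈ T

post : Pred Word 0ℓ → Word → Pred Word 0ℓ
post T τ τ′ = τ′ ∈ T × ∃ λ m → τ′ ≡ τ ∷ʳ m

IsSubtree : Pred Word 0ℓ → Pred Word 0ℓ → Set
IsSubtree T S = S ⊆ T × ∃ (IsTree S)

IsPath : Pred Word 0ℓ → Pred Word 0ℓ → Set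
IsPath T P =
  IsSubtree T P ×
  (∀ τ τ₁ τ₂ → τ ∈ P → τ₁ ∈ post P τ → τ₂ ∈ post P τ → τ₁ ≡ τ₂)

IsFiniteSubset : Pred Word 0ℓ → Pred Word 0ℓ → Set
IsFiniteSubset T S = S ⊆ T × ∃ λ (l : List Word) → ∀ τ → τ ∈ S ⇔ τ ∈ˡ l

NonBlocking : Pred Word 0ℓ → Set
NonBlocking T = ∀ τ → τ ∈ T → ∃ (post T τ)

-- The atomic propositions are Fin n.  The labelling is total on words, but
-- only its values on nodes are ever used.
record KripkeTree (n : ℕ) : Set₁ where
  field
    T           : Pred Word 0ℓ
    root        : Word
    isTree      : IsTree T root
    nonBlocking : NonBlocking T
    Lab         : Word → Subset n

record Logic : Set₂ where
  field
    Sentence : ℕ → Set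
    Sat      : ∀ {n} → KripkeTree n → Sentence n → Set₁

open Logic

infix 4 _≤ᴸ_ _≰ᴸ_

_≤ᴸ_ : Logic → Logic → Set₁
L ≤ᴸ L′ = ∀ n (φ : Sentence L n) → Σ (Sentence L′ n) λ ψ →
          ∀ (𝒯 : KripkeTree n) → Sat L 𝒯 φ ⇔ Sat L′ 𝒯 ψ

_≰ᴸ_ : Logic → Logic → Set₁
L ≰ᴸ L′ = ¬ (L ≤ᴸ L′)

data Kind : Set where
  path finite : Kind

-- Well-scoped de Bruijn syntax: i first-order and j second-order variables
-- are in scope.
data Formula (α : Kind) (n : ℕ) : ℕ → ℕ → Set where
  P     : ∀ {i j} → Fin n → Fin i → Formula α n i j
  _≤′_  : ∀ {i j} → Fin i → Fin i → Formula α n i j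
  _∈′_  : ∀ {i j} → Fin i → Fin j → Formula α n i j
  ¬′_   : ∀ {i j} → Formula α n i j → Formula α n i j
  _∧′_  : ∀ {i j} → Formula α n i j → Formula α n i j → Formula α n i j
  ∃¹_   : ∀ {i j} → Formula α n (suc i) j → Formula α n i j
  ∃²_   : ∀ {i j} → Formula α n i (suc j) → Formula α n i j

Range : Kind → Pred Word 0ℓ → Pred Word 0ℓ → Set
Range path   = IsPath
Range finite = IsFiniteSubset

module _ {n : ℕ} (𝒯 : KripkeTree n) where
  open KripkeTree 𝒯

  Holds : ∀ {α i j} → Vec Word i → Vec (Pred Word 0ℓ) j →
          Formula α n i j → Set₁
  Holds xs Xs (P a x)   = Lift 1ℓ (a ∈ˢ Lab (lookup xs x))
  Holds xs Xs (x ≤′ y)  = Lift 1ℓ (lookup xs x ≼ lookup xs y)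
  Holds xs Xs (x ∈′ X)  = Lift 1ℓ (lookup xs x ∈ lookup Xs X)
  Holds xs Xs (¬′ φ)    = ¬ Holds xs Xs φ
  Holds xs Xs (φ ∧′ ψ)  = Holds xs Xs φ × Holds xs Xs ψ
  Holds xs Xs (∃¹ φ)    = ∃ λ x → x ∈ T × Holds (x ∷ xs) Xs φ
  Holds {α} xs Xs (∃² φ) = ∃ λ X → Range α T X × Holds xs (X ∷ Xs) φ

SecondOrder : Kind → Logic
SecondOrder α = record
  { Sentence = λ n → Formula α n 0 0
  ; Sat      = λ 𝒯 → Holds 𝒯 [] []
  }

MPL WMSO : Logic
MPL  = SecondOrder path
WMSO = SecondOrder finite

Var : Set
Var = ℕ

-- Base n s Z O is the grammar of φ_{Z,O}, and Fix n Z O that of ϑ_{Z,O};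
-- the finite sets Z and O are represented by lists.  The sign s is the parity
-- of the number of negations between a base formula and the block of
-- fixpoint binders above it.  No variable crosses into a formula ϑ_{∅,∅}, so
-- counting restarts there; this is positivity of each occurrence relative
-- to its binder.
mutual
  data Base (n : ℕ) : Sign → List Var → List Var → Set where
    ff tt  : ∀ {s Z O} → Base n s Z O
    atom   : ∀ {s Z O} → Fin n → Base n s Z O
    neg    : ∀ {s Z O} → Base n (opposite s) Z O → Base n s Z O
    _∧_ _∨_ : ∀ {s Z O} → Base n s Z O → Base n s Z O → Base n s Z O
    ◇≥ □<  : ∀ {s Z O} → ℕ → Base n s O [] → Base n s Z O
    var    : ∀ {Z O} (X : Var) → X ∈ˡ Z → Base n + Z O
    closed : ∀ {s Z O} → Fix n [] [] → Base n s Z O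

  data Fix (n : ℕ) : List Var → List Var → Set where
    μ ν  : ∀ {Z O} (X : Var) → Fix n (X ∷ Z) (X ∷ O) → Fix n Z O
    base : ∀ {Z O} → Base n + Z O → Fix n Z O

Assignment : Set₁
Assignment = Var → Pred Word 0ℓ

_[_↦_] : Assignment → Var → Pred Word 0ℓ → Assignment
(χ [ X ↦ W ]) Y with Y ≟ X
... | yes _ = W
... | no  _ = χ Y

AtLeast : ∀ {ℓ} → ℕ → Pred Word ℓ → Set ℓ
AtLeast k A = Σ (Fin k → Word) λ f → Injective _≡_ _≡_ f × ∀ i → f i ∈ A

LessThan : ∀ {ℓ} → ℕ → Pred Word ℓ → Set ℓ
LessThan k A = ¬ AtLeast k A

-- Subsets of T are small predicates, whereas denotations quantify over all of
-- them and so live one universe higher.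
module _ {n : ℕ} (𝒯 : KripkeTree n) where
  open KripkeTree 𝒯

  mutual
    ⟦_⟧ᵇ : ∀ {s Z O} → Base n s Z O → Assignment → Pred Word 1ℓ
    ⟦ ff ⟧ᵇ       χ = λ _ → ⊥
    ⟦ tt ⟧ᵇ       χ = λ w → Lift 1ℓ (w ∈ T)
    ⟦ atom a ⟧ᵇ   χ = λ w → Lift 1ℓ (w ∈ T × a ∈ˢ Lab w)
    ⟦ neg φ ⟧ᵇ    χ = T ∩ ∁ (⟦ φ ⟧ᵇ χ)
    ⟦ φ ∧ ψ ⟧ᵇ    χ = ⟦ φ ⟧ᵇ χ ∩ ⟦ ψ ⟧ᵇ χ
    ⟦ φ ∨ ψ ⟧ᵇ    χ = ⟦ φ ⟧ᵇ χ ∪ ⟦ ψ ⟧ᵇ χ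
    ⟦ ◇≥ k φ ⟧ᵇ   χ = λ w → w ∈ T × AtLeast k (post T w ∩ ⟦ φ ⟧ᵇ χ)
    ⟦ □< k φ ⟧ᵇ   χ = λ w → w ∈ T × LessThan k (post T w ∩ ∁ (⟦ φ ⟧ᵇ χ))
    ⟦ var X _ ⟧ᵇ  χ = λ w → Lift 1ℓ (w ∈ χ X)
    ⟦ closed ϑ ⟧ᵇ χ = ⟦ ϑ ⟧ᶠ χ

    ⟦_⟧ᶠ : ∀ {Z O} → Fix n Z O → Assignment → Pred Word 1ℓ
    ⟦ μ X ϑ ⟧ᶠ  χ = λ w → ∀ (W : Pred Word 0ℓ) → W ⊆ T →
                          ⟦ ϑ ⟧ᶠ (χ [ X ↦ W ]) ⊆ W → w ∈ W
    ⟦ ν X ϑ ⟧ᶠ  χ = λ w → Σ (Pred Word 0ℓ) λ W → W ⊆ T ×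
                          W ⊆ ⟦ ϑ ⟧ᶠ (χ [ X ↦ W ]) × w ∈ W
    ⟦ base φ ⟧ᶠ χ = ⟦ φ ⟧ᵇ χ

-- The assignment is irrelevant for sentences.
OSGMC : Logic
OSGMC = record
  { Sentence = λ n → Fix n [] []
  ; Sat      = λ 𝒯 ϑ → KripkeTree.root 𝒯 ∈ ⟦_⟧ᶠ 𝒯 ϑ (λ _ → ∅)
  }

{-# OPTIONS --safe #-}

-- The sentence says that the root of an alternating reachability game is won:
-- p marks the targets, q the nodes where the player moves.  For each number k
-- of quantifiers take the two ω-branching game trees of height 2k in which
-- child 0 of a node has the value of the node, and all other children the value
-- that decides nothing at that node.  A single node, a finite set or (up to a
-- fixed depth) a path misses all large enough children of every node.  Where
-- all children of a tree look alike, an automorphism thus pairs child 0 of the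
-- other tree with a child that was missed, and all other children with equal
-- ones; where child 0 is the odd one out, one level below it is not.  So
-- Duplicator answers each move of the Ehrenfeucht–Fraïssé game at the cost of
-- two levels.

module Submission where

open import Defs
open import Data.Bool.Base using (Bool; true; false; not)
open import Data.Bool.Properties using (not-involutive; ¬-not) renaming (_≟_ to _≟ᵇ_)
open import Data.Fin.Base using (Fin; zero; suc)
open import Data.Fin.Subset using (Subset) renaming (_∈_ to _∈ˢ_)
open import Data.List.Base using ([]; _∷_; _++_; _∷ʳ_; map; take; length; concat)
open import Data.List.Extrema.Nat using (max; xs≤max)
open import Data.List.Membership.Propositional using () renaming (_∈_ to _∈ˡ_)
open import Data.List.Membership.Propositional.Properties using (∈-map⁺; ∈-map⁻)
open import Data.List.Properties using (∷ʳ-++; ∷ʳ-injectiveʳ; take-all)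
open import Data.List.Relation.Binary.Prefix.Heterogeneous using ([]; _∷_)
open import Data.List.Relation.Unary.All as All using (All; []; _∷_)
open import Data.List.Relation.Unary.All.Properties using (take⁺; concat⁻)
open import Data.List.Relation.Unary.Any using (here)
open import Data.Nat.Base using (ℕ; zero; suc; _*_; _⊔_; _≤_; _<_; s≤s)
open import Data.Nat.Properties
  using (_≟_; ≤-refl; ≤-pred; m≤n⇒m≤1+n; <-irrefl; ≰⇒>; m⊔n≤o⇒m≤o; m⊔n≤o⇒n≤o)
open import Data.Product.Base using (Σ; ∃; _×_; _,_; proj₁; proj₂)
open import Data.Sign.Base using (+)
open import Data.Sum.Base using (_⊎_; inj₁; inj₂; [_,_])
open import Data.Unit.Base using (⊤; tt)
open import Data.Vec.Base using (Vec; []; _∷_; lookup; here; there)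
open import Function.Base using (_∘_)
open import Function.Bundles using (mk⇔; Equivalence)
open import Level using (0ℓ; Lift; lift)
open import Relation.Binary.PropositionalEquality
  using (_≡_; _≢_; refl; sym; trans; cong; cong₂; subst; subst₂)
open import Relation.Nullary.Decidable.Core using (Dec; yes; no; ¬¬-excluded-middle)
open import Relation.Nullary.Negation.Core using (¬_; contradiction)
open import Relation.Unary using (Pred; _∈_; _⊆_; _∪_; ∅)

-- Kripke trees on the full ω-branching tree

Labelling : Set
Labelling = Word → Subset 2

full : Pred Word 0ℓ
full _ = ⊤

kripke : Labelling → KripkeTree 2
kripke L = record
  { T           = full
  ; root        = []
  ; isTree      = record
    { root∈T       = tt
    ; belowRoot    = λ τ _ → τ , refl
    ; prefixClosed = λ _ _ _ _ → tt
    }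
  ; nonBlocking = λ τ _ → τ ∷ʳ 0 , tt , 0 , refl
  ; Lab         = L
  }

-- The game trees

-- Levels are counted from the leaves; the player moves where kind is true.
kind : ℕ → Bool
kind zero    = false
kind (suc m) = not (kind m)

-- `kind m` decides nothing at a node of level `suc m`: it is false where the player moves there and
-- true where the opponent does. So child 0 alone fixes the value.
child : Bool → ℕ → ℕ → Bool
child b m zero    = b
child b m (suc _) = kind m

-- The two entries of a label are p and q.
game : Bool → ℕ → Labelling
game b zero    w       = b ∷ false ∷ []
game b (suc m) []      = false ∷ kind (suc m) ∷ []
game b (suc m) (i ∷ w) = game (child b m i) m w

-- The reachability sentence

p q : Fin 2
p = zero
q = suc zero

-- `□< 1` allows no child to fail, so this is the one-step operator whose least fixpoint is the
-- attractor of the targets.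
attractor : Base 2 + (0 ∷ []) (0 ∷ [])
attractor = atom p ∨ ((atom q ∧ ◇≥ 1 (var 0 (here refl))) ∨ (neg (atom q) ∧ □< 1 (var 0 (here refl))))

won : Fix 2 [] []
won = μ 0 (base attractor)

-- The prefixed points of `attractor`, unfolded clause by clause.
record Attracting (L : Labelling) (W : Pred Word 0ℓ) : Set where
  field
    target   : ∀ w → p ∈ˢ L w → w ∈ W
    someNext : ∀ w i → q ∈ˢ L w → w ∷ʳ i ∈ W → w ∈ W
    allNext  : ∀ w → ¬ q ∈ˢ L w → (∀ i → w ∷ʳ i ∈ W) → w ∈ W

open Attracting

satisfies : ∀ {L} → (∀ W → Attracting L W → [] ∈ W) → Logic.Sat OSGMC (kripke L) won
satisfies {L} h W _ prefixed = h W record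
  { target   = λ w p∈ → prefixed (inj₁ (lift (tt , p∈)))
  ; someNext = λ w i q∈ wi → prefixed (inj₂ (inj₁ (lift (tt , q∈) , tt ,
      (λ _ → w ∷ʳ i) , (λ { {zero} {zero} _ → refl }) , λ _ → (tt , i , refl) , lift wi)))
  ; allNext  = λ w q∉ all → prefixed (inj₂ (inj₂ ((tt , λ { (lift (_ , q∈)) → q∉ q∈ }) , tt ,
      λ { (f , _ , f∈) → escape w all (f∈ zero) })))
  }
  where
  escape : ∀ w → (∀ i → w ∷ʳ i ∈ W) → ∀ {τ} → ¬ (post full w τ × ¬ Lift 1ℓ (τ ∈ W))
  escape w all ((_ , i , refl) , ∉W) = ∉W (lift (all i))

refutes : ∀ {L} W → (∀ w → Dec (w ∈ W)) → Attracting L W → ¬ [] ∈ W →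
          ¬ Logic.Sat OSGMC (kripke L) won
refutes {L} W W? attr []∉W sat = []∉W (sat W (λ _ → tt) prefixed)
  where
  prefixed : ⟦_⟧ᵇ (kripke L) attractor ((λ _ → ∅) [ 0 ↦ W ]) ⊆ W
  prefixed {w} (inj₁ (lift (_ , p∈))) = target attr w p∈
  prefixed {w} (inj₂ (inj₁ (lift (_ , q∈) , _ , f , _ , f∈))) with f zero | f∈ zero
  ... | _ | (_ , i , refl) , lift wi = someNext attr w i q∈ wi
  prefixed {w} (inj₂ (inj₂ ((_ , q∉) , _ , lt))) = allNext attr w (λ q∈ → q∉ (lift (tt , q∈))) next
    where
    next : ∀ i → w ∷ʳ i ∈ W
    -- `□< 1` only refutes a child outside `W`; decidability turns this into membership.
    next i with W? (w ∷ʳ i)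
    ... | yes ∈W = ∈W
    ... | no  ∉W = contradiction
      ((λ _ → w ∷ʳ i) , (λ { {zero} {zero} _ → refl }) , λ _ → (tt , i , refl) , λ { (lift ∈W) → ∉W ∈W })
      lt

-- A leaf of the game continues as an infinite subtree with constant label, so its value is constant
-- as well.
value : Bool → ℕ → Word → Bool
value b zero    w       = b
value b (suc m) []      = b
value b (suc m) (i ∷ w) = value (child b m i) m w

value-root : ∀ b m → value b m [] ≡ b
value-root b zero    = refl
value-root b (suc m) = refl

q∈⇒kind : ∀ {b} m → q ∈ˢ game b (suc m) [] → kind m ≡ false
q∈⇒kind m q∈ with kind m | q∈
... | false | _ = refl
... | true  | there ()

-- Supplies the decidable prefixed point that `refutes` asks for: when `b` is false, it omits the
-- root.
value-attracting : ∀ b m → Attracting (game b m) (λ w → value b m w ≡ true)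
value-attracting b m = record { target = tgt b m ; someNext = some b m ; allNext = every b m }
  where
  tgt : ∀ b m w → p ∈ˢ game b m w → value b m w ≡ true
  tgt b zero    w       here = refl
  tgt b (suc m) (i ∷ w) p∈   = tgt (child b m i) m w p∈

  some : ∀ b m w i → q ∈ˢ game b m w → value b m (w ∷ʳ i) ≡ true → value b m w ≡ true
  some b zero    w       i       (there ()) _
  some b (suc m) []      zero    q∈ v = trans (sym (value-root b m)) v
  -- A child other than 0 has the value `kind m`, which is false where the player moves.
  some b (suc m) []      (suc i) q∈ v =
    contradiction (trans (sym (q∈⇒kind {b} m q∈)) (trans (sym (value-root (kind m) m)) v)) λ ()
  some b (suc m) (j ∷ w) i       q∈ v = some (child b m j) m w i q∈ v

  every : ∀ b m w → ¬ q ∈ˢ game b m w → (∀ i → value b m (w ∷ʳ i) ≡ true) → value b m w ≡ true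
  every b zero    w       q∉ v = v 0
  every b (suc m) []      q∉ v = trans (sym (value-root b m)) (v 0)
  every b (suc m) (j ∷ w) q∉ v = every (child b m j) m w q∉ v

Attracting-∷ : ∀ {L W} → Attracting L W → ∀ i → Attracting (L ∘ (i ∷_)) (W ∘ (i ∷_))
Attracting-∷ attr i = record
  { target   = λ w → target attr (i ∷ w)
  ; someNext = λ w → someNext attr (i ∷ w)
  ; allNext  = λ w → allNext attr (i ∷ w)
  }

-- Induction on the height, for all `W` at once so that it applies to subtrees. Where the player
-- moves, child 0 is a winning choice; where the opponent moves, `kind m` is true and every child is
-- winning.
attracts-root : ∀ m W → Attracting (game true m) W → [] ∈ W
attracts-root zero    W attr = target attr [] here
attracts-root (suc m) W attr with kind m in eq
... | false = someNext attr [] 0 q∈ (attracts-root m _ (Attracting-∷ attr 0))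
  where
  q∈ : q ∈ˢ game true (suc m) []
  q∈ = subst (λ c → q ∈ˢ (false ∷ not c ∷ [])) (sym eq) (there here)
... | true = allNext attr [] q∉ next
  where
  q∉ : ¬ q ∈ˢ game true (suc m) []
  q∉ q∈ = contradiction (trans (sym (q∈⇒kind {true} m q∈)) eq) λ ()

  child≡true : ∀ i → child true m i ≡ true
  child≡true zero    = refl
  child≡true (suc i) = eq

  next : ∀ i → (i ∷ []) ∈ W
  next i = attracts-root m (W ∘ (i ∷_))
    (subst (λ b → Attracting (game b m) (W ∘ (i ∷_))) (child≡true i) (Attracting-∷ attr i))

game-true : ∀ m → Logic.Sat OSGMC (kripke (game true m)) won
game-true m = satisfies (attracts-root m)

game-false : ∀ m → ¬ Logic.Sat OSGMC (kripke (game false m)) won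
game-false m = refutes _ (λ w → value false m w ≟ᵇ true) (value-attracting false m)
  (λ v → contradiction (trans (sym (value-root false m)) v) λ ())

-- Automorphisms of the ω-branching tree

-- Involutions suffice, since children are only ever swapped in pairs. `A i` acts below the source
-- child `i`, whose image is `σ i`; letters beyond the first `m` stay fixed.
data Auto : ℕ → Set where
  id   : ∀ {m} → Auto m
  node : ∀ {m} (σ : ℕ → ℕ) → (∀ i → σ (σ i) ≡ i) → (ℕ → Auto m) → Auto (suc m)

apply : ∀ {m} → Auto m → Word → Word
apply id           w       = w
apply (node σ e A) []      = []
apply (node σ e A) (i ∷ w) = σ i ∷ apply (A i) w

inv : ∀ {m} → Auto m → Auto m
inv id           = id
inv (node σ e A) = node σ e (λ i → inv (A (σ i)))

apply-inv : ∀ {m} (A : Auto m) w → apply A (apply (inv A) w) ≡ w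
apply-inv id           w       = refl
apply-inv (node σ e A) []      = refl
apply-inv (node σ e A) (i ∷ w) = cong₂ _∷_ (e i) (apply-inv (A (σ i)) w)

inv-apply : ∀ {m} (A : Auto m) w → apply (inv A) (apply A w) ≡ w
inv-apply id           w       = refl
inv-apply (node σ e A) []      = refl
inv-apply (node σ e A) (i ∷ w) rewrite e i = cong (i ∷_) (inv-apply (A i) w)

apply-≼ : ∀ {m} (A : Auto m) {u v} → u ≼ v → apply A u ≼ apply A v
apply-≼ id           u≼v          = u≼v
apply-≼ (node σ e A) []           = []
apply-≼ (node σ e A) (refl ∷ u≼v) = refl ∷ apply-≼ (A _) u≼v

apply-∷ʳ : ∀ {m} (A : Auto m) w i → ∃ λ j → apply A (w ∷ʳ i) ≡ apply A w ∷ʳ j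
apply-∷ʳ id           w       i = i , refl
apply-∷ʳ (node σ e A) []      i with A i
... | B = σ i , cong (σ i ∷_) (apply-[] B)
  where
  apply-[] : ∀ {m} (A : Auto m) → apply A [] ≡ []
  apply-[] id           = refl
  apply-[] (node _ _ _) = refl
apply-∷ʳ (node σ e A) (k ∷ w) i with j , eq ← apply-∷ʳ (A k) w i = j , cong (σ k ∷_) eq

-- Sim k A L L′ U: the labellings agree along A, except on pairs of game trees
-- that U avoids and that are high enough for k more moves.
data Sim (k : ℕ) : ∀ {m} → Auto m → Labelling → Labelling → Pred Word 0ℓ → Set₁ where
  same : ∀ {m L L′ U} → (∀ w → L w ≡ L′ w) → Sim k (id {m}) L L′ U
  free : ∀ {m b b′ U} → k * 2 ≤ m → (∀ w → ¬ U w) → Sim k (id {m}) (game b m) (game b′ m) U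
  node : ∀ {m σ e} {A : ℕ → Auto m} {L L′ U} → L [] ≡ L′ [] →
         (∀ i → Sim k (A i) (L ∘ (i ∷_)) (L′ ∘ (σ i ∷_)) (U ∘ (i ∷_))) →
         Sim k (node σ e A) L L′ U

Sim-sym : ∀ {k m} {A : Auto m} {L L′ U} → Sim k A L L′ U → Sim k (inv A) L′ L (U ∘ apply (inv A))
Sim-sym (same eq)   = same (sym ∘ eq)
Sim-sym (free h ∉U) = free h ∉U
Sim-sym {k} (node {σ = σ} {e} {A} {L} {L′} {U} l s) = node (sym l) λ i →
  -- The inverse at `i` comes from the pair at `σ i`, whose target is `σ (σ i)`; the transport
  -- rewrites it to `i`.
  subst (λ x → Sim k (inv (A (σ i))) (L′ ∘ (x ∷_)) (L ∘ (σ i ∷_)) (U ∘ (σ i ∷_) ∘ apply (inv (A (σ i)))))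
        (e i) (Sim-sym (s (σ i)))

Sim-label : ∀ {k m} {A : Auto m} {L L′ U} → Sim k A L L′ U → ∀ w → U w → L w ≡ L′ (apply A w)
Sim-label (same eq)   w       u = eq w
Sim-label (free _ ∉U) w       u = contradiction u (∉U w)
Sim-label (node l s)  []      u = l
Sim-label (node l s)  (i ∷ w) u = Sim-label (s i) w u

-- Answering one move

swap0 : ℕ → ℕ → ℕ
swap0 N zero = N
swap0 N i@(suc _) with i ≟ N
... | yes _ = 0
... | no  _ = i

swap0-self : ∀ N → swap0 N N ≡ 0
swap0-self zero = refl
swap0-self (suc N) with suc N ≟ suc N
... | yes _  = refl
... | no N≢N = contradiction refl N≢N

swap0-involutive : ∀ N i → swap0 N (swap0 N i) ≡ i
swap0-involutive N zero = swap0-self N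
swap0-involutive N (suc i) with suc i ≟ N
... | yes eq = sym eq
... | no neq with suc i ≟ N
...   | yes eq = contradiction eq neq
...   | no  _  = refl

-- Only child 0 can have a value other than `kind m`, and the swap sends only `N` there.
child-swap0 : ∀ b m N i → i ≢ N → child b m (swap0 N i) ≡ kind m
child-swap0 b m zero    zero i≢N = contradiction refl i≢N
child-swap0 b m (suc N) zero i≢N = refl
child-swap0 b m N (suc i) i≢N with suc i ≟ N
... | yes eq = contradiction eq i≢N
... | no  _  = refl

-- An infinite path may have unbounded letters, so only the first `m` are bounded. Then child `N` of
-- every node above that depth is missed.
Bounded : ℕ → ℕ → Pred Word 0ℓ → Set
Bounded N m X = ∀ w → X w → All (_< N) (take m w)

Bounded-∷ : ∀ {N m X} → Bounded N (suc m) X → ∀ i → Bounded N m (X ∘ (i ∷_))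
Bounded-∷ bd i w x with _ ∷ a ← bd (i ∷ w) x = a

Bounded⇒avoids : ∀ {N m X} → Bounded N (suc m) X → ∀ w → ¬ X (N ∷ w)
Bounded⇒avoids bd w x with N<N ∷ _ ← bd _ x = <-irrefl refl N<N

child-const : ∀ m i → child (kind m) m i ≡ kind m
child-const m zero    = refl
child-const m (suc _) = refl

-- The root label does not depend on `b`. The pair at `N`, where the second tree shows its child 0,
-- is `free` again because `X` misses it; at all other indices both values are `kind m`.
extend-free-const : ∀ {k m N b b′ X} → b ≡ kind m → k * 2 ≤ m → Bounded N (suc m) X →
                    Σ (Auto (suc m)) λ A → Sim k A (game b (suc m)) (game b′ (suc m)) X
extend-free-const {k} {m} {N} {b} {b′} {X} refl h bd =
  node (swap0 N) (swap0-involutive N) (λ _ → id) , node {σ = swap0 N} refl sim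
  where
  sim : ∀ i → Sim k id (game (child b m i) m) (game (child b′ m (swap0 N i)) m) (X ∘ (i ∷_))
  sim i with i ≟ N
  ... | yes refl = free h (Bounded⇒avoids bd)
  ... | no i≢N   = same λ w → cong (λ c → game c m w)
    (trans (child-const m i) (sym (child-swap0 b′ m N i i≢N)))

-- If child 0 of the first tree has the deciding value, then at child 0 the
-- first tree is the one with constant children.
extend-free : ∀ {k m N b b′ X} → suc k * 2 ≤ m → Bounded N m X →
              Σ (Auto m) λ A → Sim k A (game b m) (game b′ m) X
extend-free {k} {suc (suc m)} {N} {b} {b′} {X} (s≤s (s≤s h)) bd with b ≟ᵇ kind (suc m)
... | yes eq = extend-free-const eq (m≤n⇒m≤1+n h) bd
... | no neq = node (λ i → i) (λ _ → refl) A , node {σ = λ i → i} refl sim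
  where
  -- The value that decides at one level is the one that decides nothing a level below:
  -- `not (kind (suc m))` is `kind m`.
  at0 = extend-free-const {b′ = b′} (trans (¬-not neq) (not-involutive (kind m))) h (Bounded-∷ bd 0)

  A : ℕ → Auto (suc m)
  A zero    = proj₁ at0
  A (suc _) = id

  sim : ∀ i → Sim k (A i) (game (child b (suc m) i) (suc m)) (game (child b′ (suc m) i) (suc m)) (X ∘ (i ∷_))
  sim zero    = proj₂ at0
  sim (suc i) = same λ _ → refl

Sim-cong : ∀ {k m} {A : Auto m} {L L′ U V} → V ⊆ U → Sim k A L L′ U → Sim k A L L′ V
Sim-cong V⊆U (same eq)   = same eq
Sim-cong V⊆U (free h ∉U) = free h λ w → ∉U w ∘ V⊆U
Sim-cong V⊆U (node l s)  = node l λ i → Sim-cong V⊆U (s i)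

-- Duplicator's answer to a move `X`. Only `free` pairs are rearranged, and `U` avoids these, so the
-- images of all earlier choices are kept.
extend : ∀ {k m N} {A : Auto m} {L L′ U X} → Sim (suc k) A L L′ U → Bounded N m X →
         Σ (Auto m) λ A′ → Sim k A′ L L′ (U ∪ X) × (∀ w → U w → apply A w ≡ apply A′ w)
extend (same eq) bd = id , same eq , λ _ _ → refl
extend (free h ∉U) bd with A′ , s ← extend-free h bd =
  A′ , Sim-cong (λ { {w} (inj₁ u) → contradiction u (∉U w) ; (inj₂ x) → x }) s ,
  λ w u → contradiction u (∉U w)
extend {k} {U = U} {X} (node {σ = σ} {e} {A} {L} {L′} l s) bd =
  node σ e (λ i → proj₁ (at i)) , node l (λ i → proj₁ (proj₂ (at i))) , agree
  where
  at : ∀ i → ∃ λ A′ → Sim k A′ (L ∘ (i ∷_)) (L′ ∘ (σ i ∷_)) ((U ∪ X) ∘ (i ∷_)) ×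
                      (∀ w → U (i ∷ w) → apply (A i) w ≡ apply A′ w)
  at i = extend (s i) (Bounded-∷ bd i)

  agree : ∀ w → U w → apply (node σ e A) w ≡ apply (node σ e (λ i → proj₁ (at i))) w
  agree []      u = refl
  agree (i ∷ w) u = cong (σ i ∷_) (proj₂ (proj₂ (at i)) w u)

-- Ranges of second-order quantifiers

≼⇒++ : ∀ {u v} → u ≼ v → ∃ λ w → v ≡ u ++ w
≼⇒++ {v = v} []           = v , refl
≼⇒++         (refl ∷ u≼v) with w , refl ← ≼⇒++ u≼v = w , refl

++⇒≼ : ∀ u {v w} → v ≼ w → u ++ v ≼ u ++ w
++⇒≼ []      v≼w = v≼w
++⇒≼ (x ∷ u) v≼w = refl ∷ ++⇒≼ u v≼w

≼-++ : ∀ u {v} → u ≼ u ++ v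
≼-++ []      = []
≼-++ (x ∷ u) = refl ∷ ≼-++ u

++-≼⁻ : ∀ u {v w} → u ++ v ≼ u ++ w → v ≼ w
++-≼⁻ []      v≼w       = v≼w
++-≼⁻ (x ∷ u) (_ ∷ v≼w) = ++-≼⁻ u v≼w

-- Both words extend the root of the path. At their first disagreement the common prefix would have
-- two children in `X`.
path-comparable : ∀ {X} → IsPath full X → ∀ u v → X u → X v → u ≼ v ⊎ v ≼ u
path-comparable {X} ((_ , τ₀ , tree) , functional) u v u∈ v∈
  with u′ , refl ← IsTree.belowRoot tree u u∈ | v′ , refl ← IsTree.belowRoot tree v v∈ =
  [ inj₁ ∘ ++⇒≼ τ₀ , inj₂ ∘ ++⇒≼ τ₀ ] (go [] u′ v′ u∈ v∈)
  where
  -- `a` is the common part read so far after the root.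
  go : ∀ a u v → X (τ₀ ++ a ++ u) → X (τ₀ ++ a ++ v) → a ++ u ≼ a ++ v ⊎ a ++ v ≼ a ++ u
  go a []      v       _  _  = inj₁ (++⇒≼ a [])
  go a (x ∷ u) []      _  _  = inj₂ (++⇒≼ a [])
  go a (x ∷ u) (y ∷ v) u∈ v∈ = result
    where
    upTo : ∀ z w → X (τ₀ ++ a ++ z ∷ w) → post X (τ₀ ++ a) (τ₀ ++ a ∷ʳ z)
    upTo z w h = IsTree.prefixClosed tree _ _ h (++⇒≼ a (refl ∷ [])) , z , assoc τ₀
      where
      assoc : ∀ t → t ++ a ∷ʳ z ≡ (t ++ a) ∷ʳ z
      assoc []      = refl
      assoc (i ∷ t) = cong (i ∷_) (assoc t)

    x≡y : x ≡ y
    x≡y = ∷ʳ-injectiveʳ (τ₀ ++ a) (τ₀ ++ a)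
      (trans (sym (proj₂ (proj₂ (upTo x u u∈))))
        (trans (functional (τ₀ ++ a) _ _
          (IsTree.prefixClosed tree _ _ u∈ (≼-++ a)) (upTo x u u∈) (upTo y v v∈))
          (proj₂ (proj₂ (upTo y v v∈)))))

    result : a ++ x ∷ u ≼ a ++ y ∷ v ⊎ a ++ y ∷ v ≼ a ++ x ∷ u
    result with refl ← x≡y with ih ← go (a ∷ʳ x) u v
      rewrite ∷ʳ-++ a x u | ∷ʳ-++ a x v = ih u∈ v∈

All-≼ : ∀ {Q : Pred ℕ 0ℓ} {u v} → u ≼ v → All Q v → All Q u
All-≼ []         _        = []
All-≼ (refl ∷ h) (x ∷ xs) = x ∷ All-≼ h xs

take-≼ : ∀ m {u v} → u ≼ v → m ≤ length u → take m v ≡ take m u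
take-≼ zero    _            _       = refl
take-≼ (suc m) (refl ∷ u≼v) (s≤s h) = cong (_ ∷_) (take-≼ m u≼v h)

All-<-max : ∀ w → All (_< suc (max 0 w)) w
All-<-max w = All.map s≤s (xs≤max 0 w)

-- A node of X of length at least 1 + m bounds the first 1 + m letters of all
-- others; without such a node all words of X have length at most m.
chain-bounded : ∀ {X} → (∀ u v → X u → X v → u ≼ v ⊎ v ≼ u) → ∀ m → ¬ ¬ ∃ λ N → Bounded N m X
chain-bounded comparable zero k = k (0 , λ _ _ → [])
chain-bounded {X} comparable (suc m) k = ¬¬-excluded-middle {A = ∃ λ u → X u × suc m ≤ length u} λ where
  (yes (u , u∈ , h)) → k (suc (max 0 u) , λ v v∈ →
    [ (λ u≼v → subst (All _) (sym (take-≼ (suc m) u≼v h)) (take⁺ (suc m) (All-<-max u)))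
    , (λ v≼u → take⁺ (suc m) (All-≼ v≼u (All-<-max u))) ] (comparable u v u∈ v∈))
  (no ∄) → chain-bounded comparable m λ (N , bd) → k (N , λ v v∈ →
    let short = ≤-pred (≰⇒> λ h → ∄ (v , v∈ , h)) in
    subst (All (_< N)) (trans (take-all m v short) (sym (take-all (suc m) v (m≤n⇒m≤1+n short)))) (bd v v∈))

Range-bounded : ∀ α m {X} → Range α full X → ¬ ¬ ∃ λ N → Bounded N m X
Range-bounded path   m isPath       = chain-bounded (path-comparable isPath) m
-- The bound is one more than the largest letter occurring in any listed word.
Range-bounded finite m (_ , l , eq) k = k (_ , λ w w∈ →
  take⁺ m (All.lookup (concat⁻ {xss = l} (All-<-max (concat l))) (Equivalence.to (eq w) w∈)))

-- Makes Duplicator's answer to a set move legal. The image under `A` is written as a preimage under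
-- `inv A`, which avoids an existential.
Range-image : ∀ α {m} (A : Auto m) {X} → Range α full X → Range α full (X ∘ apply (inv A))
Range-image finite A {X} (_ , l , eq) = (λ _ → tt) , map (apply A) l , λ w → mk⇔
  (λ h → subst (λ v → v ∈ˡ map (apply A) l) (apply-inv A w)
    (∈-map⁺ (apply A) (Equivalence.to (eq _) h)))
  (λ h → let v , v∈ , w≡ = ∈-map⁻ (apply A) h in
    subst X (sym (trans (cong (apply (inv A)) w≡) (inv-apply A v))) (Equivalence.from (eq v) v∈))
Range-image path A {X} ((_ , τ₀ , tree) , functional) = ((λ _ → tt) , apply A τ₀ , tree′) , functional′
  where
  B = inv A

  tree′ : IsTree (X ∘ apply B) (apply A τ₀)
  tree′ = record
    { root∈T       = subst X (sym (inv-apply A τ₀)) (IsTree.root∈T tree)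
    ; belowRoot    = λ τ τ∈ → let v , eq = IsTree.belowRoot tree _ τ∈ in
        ≼⇒++ (subst (apply A τ₀ ≼_) (trans (cong (apply A) (sym eq)) (apply-inv A τ)) (apply-≼ A (≼-++ τ₀)))
    ; prefixClosed = convex
    }
    where
    -- `B` preserves prefixes and sends `apply A τ₀` back to `τ₀`, so it maps words above the new
    -- root to words above the old one.
    B≽τ₀ : ∀ τ → ∃ λ v → apply B (apply A τ₀ ++ τ) ≡ τ₀ ++ v
    B≽τ₀ τ = ≼⇒++ (subst (_≼ apply B (apply A τ₀ ++ τ)) (inv-apply A τ₀) (apply-≼ B (≼-++ (apply A τ₀))))

    convex : ∀ τ τ′ → X (apply B (apply A τ₀ ++ τ)) → τ′ ≼ τ → X (apply B (apply A τ₀ ++ τ′))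
    convex τ τ′ τ∈ τ′≼τ with v , eq ← B≽τ₀ τ | v′ , eq′ ← B≽τ₀ τ′ =
      subst X (sym eq′) (IsTree.prefixClosed tree v v′ (subst X eq τ∈)
        (++-≼⁻ τ₀ (subst₂ _≼_ eq′ eq (apply-≼ B (++⇒≼ (apply A τ₀) τ′≼τ)))))

  functional′ : ∀ τ τ₁ τ₂ → X (apply B τ) → post (X ∘ apply B) τ τ₁ → post (X ∘ apply B) τ τ₂ → τ₁ ≡ τ₂
  functional′ τ τ₁ τ₂ τ∈ (τ₁∈ , i , refl) (τ₂∈ , j , refl) =
    trans (sym (apply-inv A _)) (trans (cong (apply A)
      (functional _ _ _ τ∈ (τ₁∈ , apply-∷ʳ B τ i) (τ₂∈ , apply-∷ʳ B τ j))) (apply-inv A _))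

-- The Ehrenfeucht–Fraïssé game

-- `U` contains every node and set chosen so far in the first tree. Hence `A` may be replaced by any
-- automorphism that agrees with it on `U`.
record Match {m i j} (A : Auto m) (U : Pred Word 0ℓ)
             (xs ys : Vec Word i) (Xs Ys : Vec (Pred Word 0ℓ) j) : Set where
  field
    fo∈ : ∀ x → U (lookup xs x)
    fo≡ : ∀ x → apply A (lookup xs x) ≡ lookup ys x
    so⊆ : ∀ X w → lookup Xs X w → U w
    so⇒ : ∀ X w → lookup Xs X w → lookup Ys X (apply A w)
    so⇐ : ∀ X w → lookup Ys X (apply A w) → lookup Xs X w

open Match

module _ {m i j} {A : Auto m} {U : Pred Word 0ℓ}
         {xs ys : Vec Word i} {Xs Ys : Vec (Pred Word 0ℓ) j} (M : Match A U xs ys Xs Ys) where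

  fo≡⁻ : ∀ x → apply (inv A) (lookup ys x) ≡ lookup xs x
  fo≡⁻ x = trans (cong (apply (inv A)) (sym (fo≡ M x))) (inv-apply A _)

  so⇐⁻ : ∀ X w → lookup Ys X w → lookup Xs X (apply (inv A) w)
  so⇐⁻ X w h = so⇐ M X _ (subst (lookup Ys X) (sym (apply-inv A w)) h)

  Match-sym : Match (inv A) (U ∘ apply (inv A)) ys xs Ys Xs
  Match-sym = record
    { fo∈ = λ x → subst U (sym (fo≡⁻ x)) (fo∈ M x)
    ; fo≡ = fo≡⁻
    ; so⊆ = λ X w → so⊆ M X _ ∘ so⇐⁻ X w
    ; so⇒ = so⇐⁻
    ; so⇐ = λ X w h → subst (lookup Ys X) (apply-inv A w) (so⇒ M X _ h)
    }

  module _ {V : Pred Word 0ℓ} {A′ : Auto m} (agree : ∀ w → U w → apply A w ≡ apply A′ w) where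

    Match-extend : Match A′ (U ∪ V) xs ys Xs Ys
    Match-extend = record
      { fo∈ = inj₁ ∘ fo∈ M
      ; fo≡ = λ x → trans (sym (agree _ (fo∈ M x))) (fo≡ M x)
      ; so⊆ = λ X w → inj₁ ∘ so⊆ M X w
      ; so⇒ = λ X w h → subst (lookup Ys X) (agree w (so⊆ M X w h)) (so⇒ M X w h)
      ; so⇐ = so⇐′
      }
      where
      -- It is not known yet that `w` lies in `U`, so agreement is used at `v`, which does: `A′`
      -- then sends `v` and `w` to the same word, and injectivity gives `v ≡ w`.
      so⇐′ : ∀ X w → lookup Ys X (apply A′ w) → lookup Xs X w
      so⇐′ X w h = subst (lookup Xs X) v≡w v∈
        where
        v = apply (inv A) (apply A′ w)

        v∈ : lookup Xs X v
        v∈ = so⇐⁻ X _ h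

        v≡w : v ≡ w
        v≡w = trans (sym (inv-apply A′ v)) (trans
          (cong (apply (inv A′)) (trans (sym (agree v (so⊆ M X v v∈))) (apply-inv A _))) (inv-apply A′ w))

  Match-∷¹ : ∀ {x} → U x → Match A U (x ∷ xs) (apply A x ∷ ys) Xs Ys
  Match-∷¹ x∈ = record
    { fo∈ = λ { zero → x∈ ; (suc x) → fo∈ M x }
    ; fo≡ = λ { zero → refl ; (suc x) → fo≡ M x }
    ; so⊆ = so⊆ M
    ; so⇒ = so⇒ M
    ; so⇐ = so⇐ M
    }

  Match-∷² : ∀ {X} → X ⊆ U → Match A U xs ys (X ∷ Xs) (X ∘ apply (inv A) ∷ Ys)
  Match-∷² {X} X⊆ = record
    { fo∈ = fo∈ M
    ; fo≡ = fo≡ M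
    ; so⊆ = λ { zero w → X⊆ ; (suc X) → so⊆ M X }
    ; so⇒ = λ { zero w → subst X (sym (inv-apply A w)) ; (suc X) → so⇒ M X }
    ; so⇐ = λ { zero w → subst X (inv-apply A w) ; (suc X) → so⇐ M X }
    }

rank : ∀ {α n i j} → Formula α n i j → ℕ
rank (P _ _)   = 0
rank (_ ≤′ _)  = 0
rank (_ ∈′ _)  = 0
rank (¬′ φ)    = rank φ
rank (φ ∧′ ψ)  = rank φ ⊔ rank ψ
rank (∃¹ φ)    = suc (rank φ)
rank (∃² φ)    = suc (rank φ)

-- Double negation, since a bound on a path is not computable from the path.
preserve : ∀ {α i j k m} {A : Auto m} {L L′ U}
           {xs ys : Vec Word i} {Xs Ys : Vec (Pred Word 0ℓ) j} (φ : Formula α 2 i j) →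
           rank φ ≤ k → Sim k A L L′ U → Match A U xs ys Xs Ys →
           Holds (kripke L) xs Xs φ → ¬ ¬ Holds (kripke L′) ys Ys φ
preserve {L′ = L′} (P a x) _ S M (lift h) c =
  c (lift (subst (a ∈ˢ_) (trans (Sim-label S _ (fo∈ M x)) (cong L′ (fo≡ M x))) h))
preserve {A = A} (x ≤′ y) _ S M (lift h) c = c (lift (subst₂ _≼_ (fo≡ M x) (fo≡ M y) (apply-≼ A h)))
preserve {Ys = Ys} (x ∈′ X) _ S M (lift h) c = c (lift (subst (lookup Ys X) (fo≡ M x) (so⇒ M X _ h)))
-- Negation exchanges the two trees, so the game continues along the inverse automorphism.
preserve (¬′ φ) r S M h c = c λ h′ → preserve φ r (Sim-sym S) (Match-sym M) h′ h
preserve (φ ∧′ ψ) r S M (h₁ , h₂) c =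
  preserve φ (m⊔n≤o⇒m≤o _ _ r) S M h₁ λ h₁′ →
  preserve ψ (m⊔n≤o⇒n≤o (rank φ) _ r) S M h₂ λ h₂′ → c (h₁′ , h₂′)
preserve {m = m} (∃¹ φ) (s≤s r) S M (x , _ , h) c
  -- A node move is treated as the move of a singleton, bounded by the largest letter of `x`.
  with A′ , S′ , agree ← extend {X = _≡ x} S (λ { _ refl → take⁺ m (All-<-max x) }) =
  preserve φ r S′ (Match-∷¹ (Match-extend M agree) (inj₂ refl)) h λ h′ → c (apply A′ x , tt , h′)
preserve {α} {m = m} (∃² φ) (s≤s r) S M (X , X∈ , h) c = Range-bounded α m X∈ λ (N , bd) →
  let A′ , S′ , agree = extend S bd in
  preserve φ r S′ (Match-∷² (Match-extend M agree) inj₂) h λ h′ →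
  c (X ∘ apply (inv A′) , Range-image α A′ X∈ , h′)

Match-[] : ∀ {m} {A : Auto m} → Match A ∅ [] [] [] []
Match-[] = record { fo∈ = λ () ; fo≡ = λ () ; so⊆ = λ () ; so⇒ = λ () ; so⇐ = λ () }

OSGMC≰SecondOrder : ∀ α → OSGMC ≰ᴸ SecondOrder α
OSGMC≰SecondOrder α le with ψ , equiv ← le 2 won =
  -- Before the first move nothing is chosen, so the whole pair of trees is `free`; the height
  -- `rank ψ * 2` allows two levels for each nested quantifier.
  preserve ψ ≤-refl (free {b = true} {b′ = false} ≤-refl λ _ ()) Match-[]
    (Equivalence.to (equiv _) (game-true (rank ψ * 2)))
    (λ h → game-false (rank ψ * 2) (Equivalence.from (equiv _) h))

corollary4 : (OSGMC ≰ᴸ MPL) × (OSGMC ≰ᴸ WMSO)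
corollary4 = OSGMC≰SecondOrder path , OSGMC≰SecondOrder finite
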